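{- Let $v\ge2$ and $k\in\{3,4\}$. Then an optimum $(d,2)$-CDA$((d+1)v^2;k,v)$ exists for every positive integer $d$ with $d+1\le v$.
   Context: Consecutive $t$-way interaction in an $N\times k$ array $A=(a_{ij})$ over a $v$-set $V$: $T=\{(i,x_i),\dots,(i+t-1,x_{i+t-1})\}$, $1\le i\le k-t+1$, $x_r\in V$; $\rho(A,T)=\{r: a_{r,j}=x_j\ \forall (j,x_j)\in T\}$, $\rho(A,\mathcal T)=\bigcup_{T\in\mathcal T}\rho(A,T)$. A $(d,t)$-CDA$(N;k,v)$ is an $N\times k$ array over $V$ in which every $t$ consecutive columns contain every $t$-tuple at least once, and such that for every set $\mathcal T$ of exactly $d$ distinct consecutive $t$-way interactions and every consecutive $t$-way interaction $T$: $\rho(A,T)\subseteq\rho(A,\mathcal T)$ iff $T\in\mathcal T$. It is optimum if $N=(d+1)v^t$. -}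

module Defs where

open import Data.Fin using (Fin; toℕ; fromℕ<)
open import Data.Fin.Properties using (toℕ<n)
open import Data.List using (List; length)
open import Data.List.Membership.Propositional using (_∈_)
open import Data.List.Relation.Unary.Any using (Any)
open import Data.List.Relation.Unary.Unique.Propositional using (Unique)
open import Data.Nat using (ℕ; zero; suc; _+_; _*_; _∸_; _^_; _<_; s≤s; s≤s⁻¹)
open import Data.Nat.Properties using (+-identityʳ; +-suc; +-monoʳ-<; <-≤-trans)
open import Data.Vec using (Vec; lookup)
open import Function.Bundles using (_⇔_)
open import Level using (0ℓ)
open import Relation.Binary.PropositionalEquality using (_≡_)
open import Relation.Unary using (Pred; _⊆_; Satisfiable)

private
  variable
    N k v t : ℕ

Array : ℕ → ℕ → ℕ → Set
Array N k v = Fin N → Fin k → Fin v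

-- The consecutive t-way interaction {(i, x_i), …, (i+t-1, x_{i+t-1})} is stored
-- as its first column i (counted from 0, so k - t + 1 choices, none if t > k)
-- and its tuple of values.  For t ≥ 1 distinct pairs are distinct sets.
record Interaction (t k v : ℕ) : Set where
  constructor interaction
  field
    start  : Fin (suc k ∸ t)
    values : Vec (Fin v) t

open Interaction public

i<n∸t⇒i+t<n : ∀ i t n → i < n ∸ t → i + t < n
i<n∸t⇒i+t<n i zero    n       i<n rewrite +-identityʳ i = i<n
i<n∸t⇒i+t<n i (suc t) (suc n) i<n∸t rewrite +-suc i t = s≤s (i<n∸t⇒i+t<n i t n i<n∸t)

column : Fin (suc k ∸ t) → Fin t → Fin k
column {k} {t} i j = fromℕ< {toℕ i + toℕ j}
  (<-≤-trans (+-monoʳ-< (toℕ i) (toℕ<n j))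
             (s≤s⁻¹ (i<n∸t⇒i+t<n (toℕ i) t (suc k) (toℕ<n i))))

ρ : Array N k v → Interaction t k v → Pred (Fin N) 0ℓ
ρ A T r = ∀ j → A r (column (start T) j) ≡ lookup (values T) j

ρ⋃ : Array N k v → List (Interaction t k v) → Pred (Fin N) 0ℓ
ρ⋃ A 𝒯 r = Any (λ T → ρ A T r) 𝒯

-- A set of exactly d interactions is a duplicate-free list of length d.
record IsCDA (d t : ℕ) {N k v : ℕ} (A : Array N k v) : Set where
  field
    covering  : (T : Interaction t k v) → Satisfiable (ρ A T)
    detecting : (𝒯 : List (Interaction t k v)) → Unique 𝒯 → length 𝒯 ≡ d →
                (T : Interaction t k v) → (ρ A T ⊆ ρ⋃ A 𝒯) ⇔ (T ∈ 𝒯)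

record IsOptimumCDA (d t : ℕ) {N k v : ℕ} (A : Array N k v) : Set where
  field
    isCDA   : IsCDA d t A
    optimum : N ≡ (d + 1) * v ^ t

{-# OPTIONS --safe #-}
-- Suppose every interaction is covered by d + 1 rows, while two distinct
-- interactions are never both covered by two different rows.  Then d
-- interactions other than T cover at most d of the rows covering T, so the
-- array is a CDA.  Such an array, with rows indexed by (s , a , b) where s < d + 1
-- and a, b ∈ ℤ/v, is (b + s , a , b , a + s): any two adjacent entries together
-- with s determine the row, and so do the first three and the last three entries.
-- For three columns, the last one is dropped.
module Submission where

open import Defs
import Data.Fin as Fin
open import Data.Fin using (Fin; zero; toℕ; inject≤; inject₁)
open import Data.Fin.Patterns using (0F; 1F; 2F; 3F)
open import Data.Fin.Permutation using (cast-id)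
open import Data.Fin.Properties using (toℕ<n; toℕ-fromℕ<; toℕ-injective; inject≤-injective; *↔×; pigeonhole; <⇒≢)
open import Data.List using (List; length; lookup)
open import Data.List.Membership.Propositional using (_∈_)
open import Data.List.Membership.Propositional.Properties using (∈-lookup)
open import Data.List.Relation.Unary.Any using (index) renaming (map to map-Any)
open import Data.List.Relation.Unary.Any.Properties using (lookup-index)
open import Data.Nat using (ℕ; _+_; _*_; _∸_; _^_; _≤_; _<_; _%_; NonZero; >-nonZero)
open import Data.Nat.DivMod using (_mod_; %-distribˡ-+; m%n%n≡m%n; [m+n]%n≡m%n; m<n⇒m%n≡m)
open import Data.Nat.Properties using (+-assoc; +-comm; *-identityʳ; m+[n∸m]≡n; m∸n+n≡m; <⇒≤; ≤-reflexive)
open import Data.Product using (Σ; ∃₂; _×_; _,_; proj₁)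
open import Data.Product.Function.NonDependent.Propositional using (_×-↔_)
open import Data.Sum using (_⊎_; inj₁; inj₂)
open import Data.Vec using (Vec; []; _∷_)
import Data.Vec as Vec
open import Data.Vec.Properties using (tabulate-cong; tabulate∘lookup)
open import Function.Base using (_∘_)
open import Function.Bundles using (_↔_; Inverse; mk⇔)
open import Function.Construct.Composition using (_↔-∘_)
open import Function.Definitions using (Injective)
open import Function.Properties.Inverse using (↔-refl)
open import Relation.Binary.PropositionalEquality using (_≡_; _≗_; refl; sym; trans; cong; subst; module ≡-Reasoning)
open import Relation.Nullary using (contradiction)
open import Relation.Unary using (_⊆_)

open ≡-Reasoning

private
  variable
    N k v t : ℕ

lookup-extensional : ∀ {A : Set} {n} {xs ys : Vec A n} → Vec.lookup xs ≗ Vec.lookup ys → xs ≡ ys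
lookup-extensional {xs = xs} {ys} eq = begin
  xs                            ≡⟨ tabulate∘lookup xs ⟨
  Vec.tabulate (Vec.lookup xs)  ≡⟨ tabulate-cong eq ⟩
  Vec.tabulate (Vec.lookup ys)  ≡⟨ tabulate∘lookup ys ⟩
  ys                            ∎

-- Holds exactly when some interaction starting at `i` is covered by both rows; phrasing it without
-- the values leaves the separation condition dependent on starting columns alone.
AgreeFrom : Array N k v → Fin (1 + k ∸ t) → Fin N → Fin N → Set
AgreeFrom {k = k} {t = t} A i r r′ = (j : Fin t) → A r (column {k} {t} i j) ≡ A r′ (column {k} {t} i j)

ρ⇒AgreeFrom : (A : Array N k v) (T : Interaction t k v) → ∀ {r r′} →
              ρ A T r → ρ A T r′ → AgreeFrom {t = t} A (start T) r r′
ρ⇒AgreeFrom A T p q j = trans (p j) (sym (q j))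

-- The entries of `r` in the columns from the common start spell out the values of both
-- interactions.
ρ-determines : (A : Array N k v) (T T′ : Interaction t k v) → start T ≡ start T′ →
               ∀ {r} → ρ A T r → ρ A T′ r → T ≡ T′
ρ-determines A (interaction i x) (interaction .i y) refl p q =
  cong (interaction i) (lookup-extensional λ j → trans (sym (p j)) (q j))

isCDA-criterion : ∀ {d} (A : Array N k v)
  (row : Interaction t k v → Fin (d + 1) → Fin N) →
  (∀ T → Injective _≡_ _≡_ (row T)) →
  (∀ T s → ρ A T (row T s)) →
  (∀ i i′ r r′ → AgreeFrom {t = t} A i r r′ → AgreeFrom {t = t} A i′ r r′ → i ≡ i′ ⊎ r ≡ r′) →
  IsCDA d t A
isCDA-criterion {k = k} {v} {t} {d} A row row-injective row-ρ separated = record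
  -- Any of the `d + 1` rows would do. As `d + 1` does not compute to a successor, `zero` is
  -- transported from `Fin (1 + d)`.
  { covering  = λ T → row T (subst Fin (+-comm 1 d) zero) , row-ρ T _
  ; detecting = λ 𝒯 _ len T → mk⇔ (detect 𝒯 len T)
      (λ T∈𝒯 r∈ρT → map-Any (λ T≡T′ → subst (λ T → ρ A T _) T≡T′ r∈ρT) T∈𝒯)
  }
  where
  detect : (𝒯 : List (Interaction t k v)) → length 𝒯 ≡ d → (T : Interaction t k v) →
           ρ A T ⊆ ρ⋃ A 𝒯 → T ∈ 𝒯
  -- Each of the `d + 1` rows of `T` is sent to the position in `𝒯` of a member covering it. There
  -- are only `d` positions, so two rows share a member `T′`.
  detect 𝒯 len T ρT⊆ρ𝒯 = conclude (pigeonhole length𝒯<d+1 (index ∘ hit))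
    where
    length𝒯<d+1 : length 𝒯 < d + 1
    length𝒯<d+1 = ≤-reflexive (trans (cong (1 +_) len) (+-comm 1 d))

    hit : ∀ s → ρ⋃ A 𝒯 (row T s)
    hit s = ρT⊆ρ𝒯 (row-ρ T s)

    conclude : (∃₂ λ s s′ → s Fin.< s′ × index (hit s) ≡ index (hit s′)) → T ∈ 𝒯
    conclude (s , s′ , s<s′ , eq) = subst (_∈ 𝒯) (sym T≡T′) (∈-lookup (index (hit s)))
      where
      T′ : Interaction t k v
      T′ = lookup 𝒯 (index (hit s))

      s∈ρT′ : ρ A T′ (row T s)
      s∈ρT′ = lookup-index (hit s)

      s′∈ρT′ : ρ A T′ (row T s′)
      s′∈ρT′ = subst (λ i → ρ A (lookup 𝒯 i) (row T s′)) (sym eq) (lookup-index (hit s′))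

      T≡T′ : T ≡ T′
      T≡T′ with separated (start T) (start T′) _ _
                  (ρ⇒AgreeFrom A T (row-ρ T s) (row-ρ T s′)) (ρ⇒AgreeFrom A T′ s∈ρT′ s′∈ρT′)
      ... | inj₁ i≡i′ = ρ-determines A T T′ i≡i′ (row-ρ T s) s∈ρT′
      -- Different starts would force the two rows to coincide, but their labels satisfy `s < s′`.
      ... | inj₂ r≡r′ = contradiction (row-injective T r≡r′) (<⇒≢ s<s′)

module Modular (v : ℕ) .{{_ : NonZero v}} where

  infixl 6 _⊕_ _⊖_

  _⊕_ _⊖_ : Fin v → Fin v → Fin v
  x ⊕ y = (toℕ x + toℕ y) mod v
  x ⊖ y = (toℕ x + (v ∸ toℕ y)) mod v

  -- Adding `y` and then `z` is one full turn modulo `v`. Both are natural numbers rather than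
  -- residues, because the complement `v ∸ toℕ y` equals `v` when `y` is zero.
  mod-+-cancel : ∀ (x : Fin v) y z → y + z ≡ v → (toℕ ((toℕ x + y) mod v) + z) mod v ≡ x
  mod-+-cancel x y z y+z≡v = toℕ-injective (begin
    toℕ ((toℕ ((toℕ x + y) mod v) + z) mod v)  ≡⟨ toℕ-fromℕ< _ ⟩
    (toℕ ((toℕ x + y) mod v) + z) % v          ≡⟨ cong (λ n → (n + z) % v) (toℕ-fromℕ< _) ⟩
    ((toℕ x + y) % v + z) % v                  ≡⟨ %-distribˡ-+ ((toℕ x + y) % v) z v ⟩
    ((toℕ x + y) % v % v + z % v) % v          ≡⟨ cong (λ n → (n + z % v) % v) (m%n%n≡m%n (toℕ x + y) v) ⟩
    ((toℕ x + y) % v + z % v) % v              ≡⟨ %-distribˡ-+ (toℕ x + y) z v ⟨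
    (toℕ x + y + z) % v                        ≡⟨ cong (_% v) (+-assoc (toℕ x) y z) ⟩
    (toℕ x + (y + z)) % v                      ≡⟨ cong (λ n → (toℕ x + n) % v) y+z≡v ⟩
    (toℕ x + v) % v                            ≡⟨ [m+n]%n≡m%n (toℕ x) v ⟩
    toℕ x % v                                  ≡⟨ m<n⇒m%n≡m (toℕ<n x) ⟩
    toℕ x                                      ∎)

  x⊖y⊕y≡x : ∀ x y → x ⊖ y ⊕ y ≡ x
  x⊖y⊕y≡x x y = mod-+-cancel x (v ∸ toℕ y) (toℕ y) (m∸n+n≡m (<⇒≤ (toℕ<n y)))

  x⊕y⊖y≡x : ∀ x y → x ⊕ y ⊖ y ≡ x
  x⊕y⊖y≡x x y = mod-+-cancel x (toℕ y) (v ∸ toℕ y) (m+[n∸m]≡n (<⇒≤ (toℕ<n y)))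

  ⊕-comm : ∀ x y → x ⊕ y ≡ y ⊕ x
  ⊕-comm x y = cong (_mod v) (+-comm (toℕ x) (toℕ y))

  ⊕-cancelˡ : ∀ x {y z} → x ⊕ y ≡ x ⊕ z → y ≡ z
  ⊕-cancelˡ x {y} {z} eq = begin
    y          ≡⟨ x⊕y⊖y≡x y x ⟨
    y ⊕ x ⊖ x  ≡⟨ cong (_⊖ x) (trans (⊕-comm y x) (trans eq (⊕-comm x z))) ⟩
    z ⊕ x ⊖ x  ≡⟨ x⊕y⊖y≡x z x ⟩
    z          ∎

module Construction (v m : ℕ) .{{_ : NonZero v}} (m≤v : m ≤ v) where

  open Modular v

  Row : Set
  Row = Fin m × Fin v × Fin v

  -- `v ^ 2` unfolds to `v * (v * 1)`, so the inner factor is cast along `*-identityʳ`.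
  rows : Fin (m * v ^ 2) ↔ Row
  rows = (↔-refl ×-↔ ((↔-refl ×-↔ cast-id (*-identityʳ v)) ↔-∘ *↔×)) ↔-∘ *↔×

  open Inverse rows using (to; from; strictlyInverseˡ; strictlyInverseʳ)

  to-injective : Injective _≡_ _≡_ to
  to-injective {r} {r′} eq = trans (sym (strictlyInverseʳ r)) (trans (cong from eq) (strictlyInverseʳ r′))

  -- The bound `m ≤ v` is used here: distinct labels remain distinct residues.
  ι : Fin m → Fin v
  ι s = inject≤ s m≤v

  entry : Row → Fin 4 → Fin v
  entry (s , a , b) 0F = b ⊕ ι s
  entry (s , a , b) 1F = a
  entry (s , a , b) 2F = b
  entry (s , a , b) 3F = a ⊕ ι s

  -- The row with label `s` showing `x` and `y` in columns `i` and `i + 1`, found by solving the two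
  -- entries for `a` and `b`.
  solve : Fin 3 → Fin v → Fin v → Fin m → Row
  solve 0F x y s = s , y , x ⊖ ι s
  solve 1F x y s = s , x , y
  solve 2F x y s = s , y ⊖ ι s , x

  -- Every clause of `solve` keeps `s` as first component, where it can be read off again.
  solve-injective : ∀ i x y → Injective _≡_ _≡_ (from ∘ solve i x y)
  solve-injective i x y {s} {s′} eq = begin
    s                                    ≡⟨ index-solve i s ⟨
    proj₁ (to (from (solve i x y s)))    ≡⟨ cong (proj₁ ∘ to) eq ⟩
    proj₁ (to (from (solve i x y s′)))   ≡⟨ index-solve i s′ ⟩
    s′                                   ∎
    where
    index-solve : ∀ i s → proj₁ (to (from (solve i x y s))) ≡ s
    index-solve 0F s = cong proj₁ (strictlyInverseˡ (solve 0F x y s))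
    index-solve 1F s = cong proj₁ (strictlyInverseˡ (solve 1F x y s))
    index-solve 2F s = cong proj₁ (strictlyInverseˡ (solve 2F x y s))

  -- Columns 1 and 2 are `a` and `b` themselves; cancelling `b` in column 0 leaves `ι s`.
  entry-injective-012 : ∀ {r r′} → entry r 0F ≡ entry r′ 0F → entry r 1F ≡ entry r′ 1F →
                        entry r 2F ≡ entry r′ 2F → r ≡ r′
  entry-injective-012 {s , a , b} {s′ , _ , _} eq refl refl =
    cong (_, a , b) (inject≤-injective m≤v m≤v s s′ (⊕-cancelˡ b eq))

  -- The mirror case: column 3 yields `ι s` after cancelling `a`.
  entry-injective-123 : ∀ {r r′} → entry r 1F ≡ entry r′ 1F → entry r 2F ≡ entry r′ 2F →
                        entry r 3F ≡ entry r′ 3F → r ≡ r′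
  entry-injective-123 {s , a , b} {s′ , _ , _} refl refl eq =
    cong (_, a , b) (inject≤-injective m≤v m≤v s s′ (⊕-cancelˡ a eq))

  array₄ : Array (m * v ^ 2) 4 v
  array₄ = entry ∘ to

  array₃ : Array (m * v ^ 2) 3 v
  array₃ r = array₄ r ∘ inject₁

  row₄ : Interaction 2 4 v → Fin m → Fin (m * v ^ 2)
  row₄ (interaction i (x ∷ y ∷ [])) = from ∘ solve i x y

  -- Lets the rows `row₄` found for four columns serve `array₃` too.
  widen : Interaction 2 3 v → Interaction 2 4 v
  widen (interaction i xs) = interaction (inject₁ i) xs

  row₄-injective : ∀ T → Injective _≡_ _≡_ (row₄ T)
  row₄-injective (interaction i (x ∷ y ∷ [])) = solve-injective i x y

  row₄-ρ : ∀ T s → ρ array₄ T (row₄ T s)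
  row₄-ρ (interaction i (x ∷ y ∷ [])) s j = trans
    (cong (λ r → entry r (column {4} {2} i j)) (strictlyInverseˡ (solve i x y s))) (entry-solve i j)
    where
    entry-solve : ∀ i j → entry (solve i x y s) (column {4} {2} i j) ≡ Vec.lookup (x ∷ y ∷ []) j
    entry-solve 0F 0F = x⊖y⊕y≡x x (ι s)
    entry-solve 0F 1F = refl
    entry-solve 1F 0F = refl
    entry-solve 1F 1F = refl
    entry-solve 2F 0F = refl
    entry-solve 2F 1F = x⊖y⊕y≡x y (ι s)

  row₃-ρ : ∀ T s → ρ array₃ T (row₄ (widen T) s)
  row₃-ρ T s j = trans (cong (array₄ (row₄ (widen T) s)) (widen-column (start T) j)) (row₄-ρ (widen T) s j)
    where
    widen-column : ∀ i j → inject₁ (column {3} {2} i j) ≡ column {4} {2} (inject₁ i) j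
    widen-column 0F 0F = refl
    widen-column 0F 1F = refl
    widen-column 1F 0F = refl
    widen-column 1F 1F = refl

  -- Two different pairs of adjacent columns together fill all three columns, which determine the
  -- row.
  separated₃ : ∀ i i′ r r′ → AgreeFrom {t = 2} array₃ i r r′ → AgreeFrom {t = 2} array₃ i′ r r′ →
               i ≡ i′ ⊎ r ≡ r′
  separated₃ 0F 0F r r′ p q = inj₁ refl
  separated₃ 0F 1F r r′ p q = inj₂ (to-injective (entry-injective-012 (p 0F) (p 1F) (q 1F)))
  separated₃ 1F 0F r r′ p q = inj₂ (to-injective (entry-injective-012 (q 0F) (q 1F) (p 1F)))
  separated₃ 1F 1F r r′ p q = inj₁ refl

  -- Two different pairs of adjacent columns together contain columns 0, 1, 2 or columns 1, 2, 3,
  -- and either triple determines the row.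
  separated₄ : ∀ i i′ r r′ → AgreeFrom {t = 2} array₄ i r r′ → AgreeFrom {t = 2} array₄ i′ r r′ →
               i ≡ i′ ⊎ r ≡ r′
  separated₄ 0F 0F r r′ p q = inj₁ refl
  separated₄ 0F 1F r r′ p q = inj₂ (to-injective (entry-injective-012 (p 0F) (p 1F) (q 1F)))
  separated₄ 0F 2F r r′ p q = inj₂ (to-injective (entry-injective-012 (p 0F) (p 1F) (q 0F)))
  separated₄ 1F 0F r r′ p q = inj₂ (to-injective (entry-injective-012 (q 0F) (q 1F) (p 1F)))
  separated₄ 1F 1F r r′ p q = inj₁ refl
  separated₄ 1F 2F r r′ p q = inj₂ (to-injective (entry-injective-123 (p 0F) (p 1F) (q 1F)))
  separated₄ 2F 0F r r′ p q = inj₂ (to-injective (entry-injective-012 (q 0F) (q 1F) (p 0F)))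
  separated₄ 2F 1F r r′ p q = inj₂ (to-injective (entry-injective-123 (q 0F) (q 1F) (p 1F)))
  separated₄ 2F 2F r r′ p q = inj₁ refl

mainTheorem14 : (v k : ℕ) → 2 ≤ v → (k ≡ 3 ⊎ k ≡ 4) →
    (d : ℕ) → 1 ≤ d → d + 1 ≤ v →
    Σ (Array ((d + 1) * v ^ 2) k v) (λ A → IsOptimumCDA d 2 A)
mainTheorem14 v k 2≤v k∈ d _ d+1≤v = optimum-array k∈
  where
  instance
    v≢0 : NonZero v
    -- `2 ≤ v` is `1 < v`, which weakens to `1 ≤ v`, that is, `0 < v`.
    v≢0 = >-nonZero (<⇒≤ 2≤v)
  open Construction v (d + 1) d+1≤v
  optimum-array : ∀ {k} → k ≡ 3 ⊎ k ≡ 4 → Σ (Array ((d + 1) * v ^ 2) k v) (λ A → IsOptimumCDA d 2 A)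
  optimum-array (inj₁ refl) = array₃ , record
    { isCDA   = isCDA-criterion array₃ (row₄ ∘ widen) (row₄-injective ∘ widen) row₃-ρ separated₃
    ; optimum = refl
    }
  optimum-array (inj₂ refl) = array₄ , record
    { isCDA   = isCDA-criterion array₄ row₄ row₄-injective row₄-ρ separated₄
    ; optimum = refl
    }
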